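{- For every connected graph $G$, there is a homeomorphism $\mathrm{Ult}(\mathfrak C(G))\approx\mathcal D_E(G)$ between the ultrafilter space of the cut algebra of $G$ and the edge-direction space of $G$.
   Context: Graphs are simple and undirected, possibly infinite. Cut algebra. For $A\subset V(G)$ let $E(A,G\setminus A)$ be the set of edges with one end in $A$ and the other in $V(G)\setminus A$. Let $\mathfrak c(G)=\{A\subset V(G) : E(A,G\setminus A)\text{ is finite}\}$, a Boolean subalgebra of $2^{V(G)}$, and let $I_G$ be the ideal of finite sets of vertices all of which have finite degree. The (finite) cut algebra is $\mathfrak C(G)=\mathfrak c(G)/I_G$ (elements $A,B$ are identified when $A\,\Delta\,B\in I_G$). Ultrafilter space. For a Boolean algebra $\mathfrak B$ (the one-element algebra is allowed), a filter is a nonempty upward closed subset closed under $\wedge$ and not containing $0$; an ultrafilter is a maximal filter. $\mathrm{Ult}(\mathfrak B)$ is the set of ultrafilters with basic open sets $[B]=\{u : B\in u\}$, $B\in\mathfrak B$ (empty if $0=1$). Edge-direction space. For finite $F\subset E(G)$, let $\mathcal S^E_F$ be the set of infinite connected components of $G\setminus F$ (edges of $F$ deleted). $\mathcal D_E(G)$ is the set of functions $\rho$ assigning to each finite $F\subset E(G)$ an element $\rho(F)\in\mathcal S^E_F$ such that $\rho(F')\subset\rho(F)$ whenever $F\subset F'$, with the topology whose basic open sets are $\{\rho' : \rho'(F)=\rho(F)\}$ for $\rho\in\mathcal D_E(G)$ and $F\subset E(G)$ finite (i.e. the inverse limit topology with discrete $\mathcal S^E_F$). -}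

module Defs where

open import Algebra.Lattice.Bundles using (BooleanAlgebra)
import Algebra.Lattice.Properties.Lattice as LatticeProperties
open import Data.Bool.Base as Bool using (Bool; true; false; T; _xor_)
import Data.Bool.Properties as Boolₚ
open import Data.List.Base using (List; []; _++_)
open import Data.List.Membership.Propositional using () renaming (_∈_ to _∈ₗ_)
open import Data.List.Membership.Propositional.Properties using (∈-++⁺ˡ; ∈-++⁺ʳ)
open import Data.Product.Base using (Σ; ∃; _×_; _,_; proj₁; proj₂; uncurry)
open import Data.Sum.Base as Sum using (_⊎_; inj₁; inj₂)
open import Data.Unit.Base using (tt)
open import Function.Base using (_∘_)
open import Function.Bundles using (Inverse)
open import Level using (Level; suc; _⊔_)
open import Relation.Binary.Bundles using (Setoid; Poset)
open import Relation.Binary.Core using (Rel)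
open import Relation.Binary.Construct.Closure.ReflexiveTransitive
  using (Star; ε; _◅◅_; reverse)
import Relation.Binary.Construct.On as On
open import Relation.Binary.Definitions using (Symmetric; Irreflexive; _Respects_)
open import Relation.Binary.Lattice.Structures using (module IsLattice)
open import Relation.Binary.PropositionalEquality
  using (_≡_; _≢_; _≗_; refl; sym; cong)
open import Relation.Binary.Structures using (IsEquivalence)
open import Relation.Nullary.Negation using (¬_; contradiction)
open import Relation.Unary using (Pred; _∈_; _⊆_; _∩_; _∪_; _≐_; _⊢_; Satisfiable)
open import Relation.Unary.Properties using (≐-refl; ≐-sym; ≐-trans)
open import Relation.Unary.Relation.Binary.Equality using (≐-setoid)

private
  variable
    a b p q ℓ : Level
    A : Set a

-- The list may contain elements outside P; given excluded middle they can be
-- removed.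

Finite : {A : Set a} → Pred A p → Set (a ⊔ p)
Finite {A = A} P = ∃ λ (xs : List A) → P ⊆ (_∈ₗ xs)

Infinite : {A : Set a} → Pred A p → Set (a ⊔ p)
Infinite P = ¬ Finite P

finite-⊆ : {P : Pred A p} {Q : Pred A q} → P ⊆ Q → Finite Q → Finite P
finite-⊆ P⊆Q (xs , Q⊆xs) = xs , Q⊆xs ∘ P⊆Q

finite-∪ : {P : Pred A p} {Q : Pred A q} → Finite P → Finite Q → Finite (P ∪ Q)
finite-∪ (xs , P⊆xs) (ys , Q⊆ys) =
  xs ++ ys , Sum.[ ∈-++⁺ˡ ∘ P⊆xs , ∈-++⁺ʳ xs ∘ Q⊆ys ]

-- Points together with a basis of the topology; Open is the topology generated.

record Space c ℓ i b : Set (suc (c ⊔ ℓ ⊔ i ⊔ b)) where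
  field
    points : Setoid c ℓ
  open Setoid points public
  field
    Index      : Set i
    basic      : Index → Pred Carrier b
    basic-resp : ∀ i → basic i Respects _≈_
    covering   : ∀ x → ∃ λ i → x ∈ basic i
    refining   : ∀ i j {x} → x ∈ basic i → x ∈ basic j →
                 ∃ λ k → x ∈ basic k × basic k ⊆ basic i ∩ basic j

  Open : Pred Carrier p → Set (c ⊔ i ⊔ b ⊔ p)
  Open U = ∀ {x} → x ∈ U → ∃ λ i → x ∈ basic i × basic i ⊆ U

module _ {c₁ ℓ₁ i₁ b₁ c₂ ℓ₂ i₂ b₂}
         (X : Space c₁ ℓ₁ i₁ b₁) (Y : Space c₂ ℓ₂ i₂ b₂) where
  private
    module X = Space X
    module Y = Space Y

  Continuous : (X.Carrier → Y.Carrier) → Set (c₁ ⊔ i₁ ⊔ b₁ ⊔ c₂ ⊔ i₂ ⊔ suc b₂)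
  Continuous f = (U : Pred Y.Carrier b₂) → Y.Open U → X.Open (f ⊢ U)

record Homeomorphism {c₁ ℓ₁ i₁ b₁ c₂ ℓ₂ i₂ b₂}
         (X : Space c₁ ℓ₁ i₁ b₁) (Y : Space c₂ ℓ₂ i₂ b₂)
         : Set (c₁ ⊔ ℓ₁ ⊔ i₁ ⊔ suc b₁ ⊔ c₂ ⊔ ℓ₂ ⊔ i₂ ⊔ suc b₂) where
  field
    bijection : Inverse (Space.points X) (Space.points Y)
  open Inverse bijection public
  field
    to-continuous   : Continuous X Y to
    from-continuous : Continuous Y X from

module _ {c ℓ} (𝔹 : BooleanAlgebra c ℓ) where
  open BooleanAlgebra 𝔹
    using (Carrier; _∧_; ⊥; lattice)
  open LatticeProperties lattice using (poset; ∨-∧-isOrderTheoreticLattice)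
  open Poset poset using (_≤_)
  open IsLattice ∨-∧-isOrderTheoreticLattice using (x∧y≤x; x∧y≤y)

  -- Upward closure makes a filter respect the equality of 𝔹.

  record IsFilter (𝓕 : Pred Carrier p) : Set (c ⊔ ℓ ⊔ p) where
    field
      nonempty      : Satisfiable 𝓕
      upward-closed : ∀ {x y} → x ≤ y → x ∈ 𝓕 → y ∈ 𝓕
      ∧-closed      : ∀ {x y} → x ∈ 𝓕 → y ∈ 𝓕 → x ∧ y ∈ 𝓕
      proper        : ¬ (⊥ ∈ 𝓕)

  record IsUltrafilter (𝓤 : Pred Carrier p) : Set (c ⊔ ℓ ⊔ suc p) where
    field
      isFilter : IsFilter 𝓤
      maximal  : {𝓕 : Pred Carrier p} → IsFilter 𝓕 → 𝓤 ⊆ 𝓕 → 𝓕 ⊆ 𝓤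
    open IsFilter isFilter public

  Ultrafilter : Set (suc (c ⊔ ℓ))
  Ultrafilter = Σ (Pred Carrier (c ⊔ ℓ)) IsUltrafilter

  Ult : Space (suc (c ⊔ ℓ)) (c ⊔ ℓ) c (c ⊔ ℓ)
  Ult = record
    { points     = On.setoid {B = Ultrafilter} (≐-setoid Carrier (c ⊔ ℓ)) proj₁
    ; Index      = Carrier
    ; basic      = λ B u → B ∈ proj₁ u
    ; basic-resp = λ _ u≐v → proj₁ u≐v
    ; covering   = λ u → IsUltrafilter.nonempty (proj₂ u)
    ; refining   = λ B C {u} B∈u C∈u →
        B ∧ C , IsUltrafilter.∧-closed (proj₂ u) B∈u C∈u , λ {v} B∧C∈v →
          IsUltrafilter.upward-closed (proj₂ v) (x∧y≤x B C) B∧C∈v ,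
          IsUltrafilter.upward-closed (proj₂ v) (x∧y≤y B C) B∧C∈v
    }

record Graph ℓ : Set (suc ℓ) where
  field
    V      : Set ℓ
    Adj    : Rel V ℓ
    symm   : Symmetric Adj
    irrefl : Irreflexive _≡_ Adj

module _ {ℓ} (G : Graph ℓ) where
  open Graph G

  Connected : Set ℓ
  Connected = ∀ x y → Star Adj x y

  FiniteDegree : Pred V ℓ
  FiniteDegree x = Finite (Adj x)

  -- A set of undirected edges is a symmetric subrelation of adjacency; every
  -- edge occurs in it as two ordered pairs, which does not affect finiteness.

  record EdgeSet : Set (suc ℓ) where
    field
      Edge      : Rel V ℓ
      edge-symm : Symmetric Edge
      edge-adj  : ∀ {x y} → Edge x y → Adj x y

  open EdgeSet

  _⊆ᴱ_ : Rel EdgeSet ℓ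
  F ⊆ᴱ F′ = ∀ {x y} → Edge F x y → Edge F′ x y

  FiniteEdges : Pred EdgeSet ℓ
  FiniteEdges F = Finite (uncurry (Edge F))

  FiniteEdgeSet : Set (suc ℓ)
  FiniteEdgeSet = Σ EdgeSet FiniteEdges

  -- The power set of V is V → Bool: with excluded middle, every subset has a
  -- characteristic function.

  ∂ : (V → Bool) → EdgeSet
  ∂ A = record
    { Edge      = λ x y → Adj x y × A x ≢ A y
    ; edge-symm = λ (e , A≢) → symm e , A≢ ∘ sym
    ; edge-adj  = proj₁
    }

  Cut : Set ℓ
  Cut = Σ (V → Bool) λ A → FiniteEdges (∂ A)

  -- The ideal I_G; the quotient by it is taken as a setoid, via _≈ᶜ_.

  Negligible : Pred (V → Bool) ℓ
  Negligible A = Finite (T ∘ A) × (∀ x → T (A x) → FiniteDegree x)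

  _△_ : (V → Bool) → (V → Bool) → (V → Bool)
  (A △ B) x = A x xor B x

  _≈ᶜ_ : Rel Cut ℓ
  (A , _) ≈ᶜ (B , _) = Negligible (A △ B)

  negl-⊆ : ∀ {A B} → (∀ x → T (A x) → T (B x)) → Negligible B → Negligible A
  negl-⊆ A⊆B (fin , deg) =
    finite-⊆ (λ {x} → A⊆B x) fin , λ x → deg x ∘ A⊆B x

  negl-∪ : ∀ {A B C} → (∀ x → T (C x) → T (A x) ⊎ T (B x)) →
           Negligible A → Negligible B → Negligible C
  negl-∪ C⊆A∪B (finA , degA) (finB , degB) =
    finite-⊆ (λ {x} → C⊆A∪B x) (finite-∪ finA finB) ,
    λ x → Sum.[ degA x , degB x ] ∘ C⊆A∪B x

  xor-∧ : ∀ a b c d → T ((a Bool.∧ c) xor (b Bool.∧ d)) → T (a xor b) ⊎ T (c xor d)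
  xor-∧ true  true  c     d     t = inj₂ t
  xor-∧ true  false c     d     t = inj₁ tt
  xor-∧ false true  c     d     t = inj₁ tt
  xor-∧ false false c     d     ()

  xor-∨ : ∀ a b c d → T ((a Bool.∨ c) xor (b Bool.∨ d)) → T (a xor b) ⊎ T (c xor d)
  xor-∨ true  true  c     d     ()
  xor-∨ true  false c     d     t = inj₁ tt
  xor-∨ false true  c     d     t = inj₁ tt
  xor-∨ false false c     d     t = inj₂ t

  xor-trans : ∀ a b c → T (a xor c) → T (a xor b) ⊎ T (b xor c)
  xor-trans true  true  c t = inj₂ t
  xor-trans true  false c t = inj₁ tt
  xor-trans false true  c t = inj₁ tt
  xor-trans false false c t = inj₂ t

  ≢-split : ∀ (_∙_ : Bool → Bool → Bool) a b c d → (a ∙ c) ≢ (b ∙ d) → a ≢ b ⊎ c ≢ d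
  ≢-split _∙_ true  true  c d n = inj₂ λ c≡d → n (cong (true ∙_) c≡d)
  ≢-split _∙_ true  false c d n = inj₁ λ ()
  ≢-split _∙_ false true  c d n = inj₁ λ ()
  ≢-split _∙_ false false c d n = inj₂ λ c≡d → n (cong (false ∙_) c≡d)

  ∂-pointwise : ∀ (_∙_ : Bool → Bool → Bool) {A B} →
                FiniteEdges (∂ A) → FiniteEdges (∂ B) →
                FiniteEdges (∂ λ x → A x ∙ B x)
  ∂-pointwise _∙_ {A} {B} finA finB = finite-⊆
    (λ {(x , y)} (e , n) →
      Sum.map (e ,_) (e ,_) (≢-split _∙_ (A x) (A y) (B x) (B y) n))
    (finite-∪ finA finB)

  ∂-const : ∀ b → FiniteEdges (∂ λ _ → b)
  ∂-const b = [] , λ (_ , b≢b) → contradiction refl b≢b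

  _∩ᶜ_ _∪ᶜ_ : Cut → Cut → Cut
  (A , finA) ∩ᶜ (B , finB) =
    (λ x → A x Bool.∧ B x) , ∂-pointwise Bool._∧_ finA finB
  (A , finA) ∪ᶜ (B , finB) =
    (λ x → A x Bool.∨ B x) , ∂-pointwise Bool._∨_ finA finB

  ∁ᶜ : Cut → Cut
  ∁ᶜ (A , fin) =
    (λ x → Bool.not (A x)) ,
    finite-⊆ (λ (e , n) → e , n ∘ cong Bool.not) fin

  V-cut ∅-cut : Cut
  V-cut = (λ _ → true) , ∂-const true
  ∅-cut = (λ _ → false) , ∂-const false

  ≗⇒≈ : ∀ (X Y : Cut) → proj₁ X ≗ proj₁ Y → X ≈ᶜ Y
  ≗⇒≈ X Y X≗Y = ([] , λ {x} t → contradiction t (empty x)) ,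
                λ x t → contradiction t (empty x)
    where
    xor-≡ : ∀ {a b} → a ≡ b → ¬ T (a xor b)
    xor-≡ {true}  refl ()
    xor-≡ {false} refl ()

    empty : ∀ x → ¬ T ((proj₁ X △ proj₁ Y) x)
    empty x = xor-≡ (X≗Y x)

  ≈ᶜ-isEquivalence : IsEquivalence _≈ᶜ_
  ≈ᶜ-isEquivalence = record
    { refl  = λ {X} → ≗⇒≈ X X λ _ → refl
    ; sym   = λ {(A , _)} {(B , _)} →
        negl-⊆ λ x t → xor-sym (B x) (A x) t
    ; trans = λ {(A , _)} {(B , _)} {(C , _)} →
        negl-∪ λ x → xor-trans (A x) (B x) (C x)
    }
    where
    xor-sym : ∀ a b → T (a xor b) → T (b xor a)
    xor-sym true  false t = tt
    xor-sym false true  t = tt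

  cutAlgebra : BooleanAlgebra ℓ ℓ
  cutAlgebra = record
    { Carrier          = Cut
    ; _≈_              = _≈ᶜ_
    ; _∨_              = _∪ᶜ_
    ; _∧_              = _∩ᶜ_
    ; ¬_               = ∁ᶜ
    ; ⊤                = V-cut
    ; ⊥                = ∅-cut
    ; isBooleanAlgebra = record
      { isDistributiveLattice = record
        { isLattice = record
          { isEquivalence = ≈ᶜ-isEquivalence
          ; ∨-comm     = λ X Y → ≗⇒≈ (X ∪ᶜ Y) (Y ∪ᶜ X)
              λ x → Boolₚ.∨-comm (proj₁ X x) (proj₁ Y x)
          ; ∨-assoc    = λ X Y Z → ≗⇒≈ ((X ∪ᶜ Y) ∪ᶜ Z) (X ∪ᶜ (Y ∪ᶜ Z))
              λ x → Boolₚ.∨-assoc (proj₁ X x) (proj₁ Y x) (proj₁ Z x)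
          ; ∨-cong     = λ {X} {Y} {Z} {W} → negl-∪
              λ x → xor-∨ (proj₁ X x) (proj₁ Y x) (proj₁ Z x) (proj₁ W x)
          ; ∧-comm     = λ X Y → ≗⇒≈ (X ∩ᶜ Y) (Y ∩ᶜ X)
              λ x → Boolₚ.∧-comm (proj₁ X x) (proj₁ Y x)
          ; ∧-assoc    = λ X Y Z → ≗⇒≈ ((X ∩ᶜ Y) ∩ᶜ Z) (X ∩ᶜ (Y ∩ᶜ Z))
              λ x → Boolₚ.∧-assoc (proj₁ X x) (proj₁ Y x) (proj₁ Z x)
          ; ∧-cong     = λ {X} {Y} {Z} {W} → negl-∪
              λ x → xor-∧ (proj₁ X x) (proj₁ Y x) (proj₁ Z x) (proj₁ W x)
          ; absorptive =
              (λ X Y → ≗⇒≈ (X ∪ᶜ (X ∩ᶜ Y)) X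
                λ x → Boolₚ.∨-abs-∧ (proj₁ X x) (proj₁ Y x)) ,
              (λ X Y → ≗⇒≈ (X ∩ᶜ (X ∪ᶜ Y)) X
                λ x → Boolₚ.∧-abs-∨ (proj₁ X x) (proj₁ Y x))
          }
        ; ∨-distrib-∧ =
            (λ X Y Z → ≗⇒≈ (X ∪ᶜ (Y ∩ᶜ Z)) ((X ∪ᶜ Y) ∩ᶜ (X ∪ᶜ Z))
              λ x → Boolₚ.∨-distribˡ-∧ (proj₁ X x) (proj₁ Y x) (proj₁ Z x)) ,
            (λ X Y Z → ≗⇒≈ ((Y ∩ᶜ Z) ∪ᶜ X) ((Y ∪ᶜ X) ∩ᶜ (Z ∪ᶜ X))
              λ x → Boolₚ.∨-distribʳ-∧ (proj₁ X x) (proj₁ Y x) (proj₁ Z x))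
        ; ∧-distrib-∨ =
            (λ X Y Z → ≗⇒≈ (X ∩ᶜ (Y ∪ᶜ Z)) ((X ∩ᶜ Y) ∪ᶜ (X ∩ᶜ Z))
              λ x → Boolₚ.∧-distribˡ-∨ (proj₁ X x) (proj₁ Y x) (proj₁ Z x)) ,
            (λ X Y Z → ≗⇒≈ ((Y ∪ᶜ Z) ∩ᶜ X) ((Y ∩ᶜ X) ∪ᶜ (Z ∩ᶜ X))
              λ x → Boolₚ.∧-distribʳ-∨ (proj₁ X x) (proj₁ Y x) (proj₁ Z x))
        }
      ; ∨-complement =
          (λ X → ≗⇒≈ (∁ᶜ X ∪ᶜ X) V-cut λ x → Boolₚ.∨-inverseˡ (proj₁ X x)) ,
          (λ X → ≗⇒≈ (X ∪ᶜ ∁ᶜ X) V-cut λ x → Boolₚ.∨-inverseʳ (proj₁ X x))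
      ; ∧-complement =
          (λ X → ≗⇒≈ (∁ᶜ X ∩ᶜ X) ∅-cut λ x → Boolₚ.∧-inverseˡ (proj₁ X x)) ,
          (λ X → ≗⇒≈ (X ∩ᶜ ∁ᶜ X) ∅-cut λ x → Boolₚ.∧-inverseʳ (proj₁ X x))
      ; ¬-cong = λ {X} {Y} → negl-⊆ λ x → xor-not (proj₁ X x) (proj₁ Y x)
      }
    }
    where
    xor-not : ∀ a b → T (Bool.not a xor Bool.not b) → T (a xor b)
    xor-not true  false t = tt
    xor-not false true  t = tt

  AdjWithout : EdgeSet → Rel V ℓ
  AdjWithout F x y = Adj x y × ¬ Edge F x y

  -- A component is identified with its vertex set.

  IsComponent : EdgeSet → Pred V ℓ → Set ℓ
  IsComponent F C = ∃ λ x → C ≐ Star (AdjWithout F) x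

  InfiniteComponent : EdgeSet → Set (suc ℓ)
  InfiniteComponent F = ∃ λ C → IsComponent F C × Infinite C

  -- The value of a direction depends only on the set of edges: by
  -- monotonicity, F ⊆ᴱ F′ ⊆ᴱ F forces the two values to be equal.

  record EdgeDirection : Set (suc ℓ) where
    field
      direction : (F : FiniteEdgeSet) → InfiniteComponent (proj₁ F)

    _⟨_⟩ : FiniteEdgeSet → Pred V ℓ
    _⟨_⟩ F = proj₁ (direction F)

    field
      monotone : ∀ F F′ → proj₁ F ⊆ᴱ proj₁ F′ → _⟨_⟩ F′ ⊆ _⟨_⟩ F

  open EdgeDirection using (direction; monotone; _⟨_⟩)

  _∪ᴱ_ : FiniteEdgeSet → FiniteEdgeSet → FiniteEdgeSet
  (F , finF) ∪ᴱ (F′ , finF′) = record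
    { Edge      = λ x y → Edge F x y ⊎ Edge F′ x y
    ; edge-symm = Sum.map (edge-symm F) (edge-symm F′)
    ; edge-adj  = Sum.[ edge-adj F , edge-adj F′ ]
    } , finite-∪ finF finF′

  component-satisfiable : ∀ {F C} → IsComponent F C → Satisfiable C
  component-satisfiable (x , _ , star⊆C) = x , star⊆C ε

  component-⊆ : ∀ {F C D x} → IsComponent F C → IsComponent F D →
                x ∈ C → x ∈ D → C ⊆ D
  component-⊆ {F} (_ , C⊆ , _) (_ , D⊆ , ⊆D) x∈C x∈D z∈C =
    ⊆D (D⊆ x∈D ◅◅ reverse (λ (e , n) → symm e , n ∘ edge-symm F) (C⊆ x∈C) ◅◅ C⊆ z∈C)

  component-≐ : ∀ {F C D x} → IsComponent F C → IsComponent F D →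
                x ∈ C → x ∈ D → C ≐ D
  component-≐ {F} c d x∈C x∈D =
    component-⊆ {F} c d x∈C x∈D , component-⊆ {F} d c x∈D x∈C

  direction-≐ : ∀ ρ σ F F′ → proj₁ F ⊆ᴱ proj₁ F′ →
                (σ ⟨ F′ ⟩) ≐ (ρ ⟨ F′ ⟩) → (σ ⟨ F ⟩) ≐ (ρ ⟨ F ⟩)
  direction-≐ ρ σ F F′ F⊆F′ (σ⊆ρ , _)
    with x , x∈σ ← component-satisfiable {proj₁ F′} (proj₁ (proj₂ (direction σ F′)))
    = component-≐ {proj₁ F}
        (proj₁ (proj₂ (direction σ F))) (proj₁ (proj₂ (direction ρ F)))
        (monotone σ F F′ F⊆F′ x∈σ) (monotone ρ F F′ F⊆F′ (σ⊆ρ x∈σ))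

  ∅ᴱ : FiniteEdgeSet
  ∅ᴱ = ∂ (λ _ → true) , ∂-const true

  edgeDirectionSpace : Space (suc ℓ) (suc ℓ) (suc ℓ) ℓ
  edgeDirectionSpace = record
    { points     = record
      { Carrier       = EdgeDirection
      ; _≈_           = λ ρ σ → ∀ F → (ρ ⟨ F ⟩) ≐ (σ ⟨ F ⟩)
      ; isEquivalence = record
        { refl  = λ F → ≐-refl
        ; sym   = λ ρ≐σ F → ≐-sym (ρ≐σ F)
        ; trans = λ ρ≐σ σ≐τ F → ≐-trans (ρ≐σ F) (σ≐τ F)
        }
      }
    ; Index      = EdgeDirection × FiniteEdgeSet
    ; basic      = λ (ρ , F) ρ′ → (ρ′ ⟨ F ⟩) ≐ (ρ ⟨ F ⟩)
    ; basic-resp = λ (ρ , F) σ≐τ σ≐ρ → ≐-trans (≐-sym (σ≐τ F)) σ≐ρ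
    ; covering   = λ ρ → (ρ , ∅ᴱ) , ≐-refl
    ; refining   = λ (ρ , F) (ρ′ , F′) {σ} σ≐ρ σ≐ρ′ →
        (σ , F ∪ᴱ F′) , ≐-refl , λ {τ} τ≐σ →
          ≐-trans (direction-≐ σ τ F (F ∪ᴱ F′) inj₁ τ≐σ) σ≐ρ ,
          ≐-trans (direction-≐ σ τ F′ (F ∪ᴱ F′) inj₂ τ≐σ) σ≐ρ′
    }

{-# OPTIONS --safe #-}

-- For a finite edge set F the connected graph G has only finitely many
-- components after deleting F, each a cut with boundary in F, and the finite
-- ones are negligible because they cannot contain a vertex of infinite degree.
-- So an ultrafilter u contains exactly one component C of each G ∖ F, and
-- F ↦ C is a direction.  Conversely, deleting ∂A leaves no edge between A and
-- its complement, so a direction ρ decides every cut A: either ρ(∂A) ⊆ A or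
-- ρ(∂A) ⊆ V ∖ A, and the cuts of the first kind form an ultrafilter.  Both
-- maps are continuous: C ∈ u alone determines the component chosen at F, and
-- ρ(∂A) alone determines whether A belongs to the ultrafilter.

module Submission where

open import Defs
open import Axiom.ExcludedMiddle using (ExcludedMiddle)
open import Algebra.Lattice.Bundles using (BooleanAlgebra)
import Algebra.Lattice.Properties.BooleanAlgebra as BooleanAlgebraProperties
open import Data.Bool.Base as Bool using (Bool; true; false; T; _xor_)
open import Data.Bool.Properties using (T-∧; ∧-inverseʳ)
open import Data.List.Base using (List; []; _∷_; _++_; map)
open import Data.List.Membership.Propositional using () renaming (_∈_ to _∈ₗ_)
open import Data.List.Membership.Propositional.Properties
  using (∈-++⁺ˡ; ∈-++⁺ʳ; ∈-map⁺)
open import Data.List.Relation.Unary.Any using (here; there)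
open import Data.Product.Base using (∃; _×_; _,_; proj₁; proj₂; map₂)
open import Data.Sum.Base using (_⊎_; inj₁; inj₂)
open import Data.Unit.Base using (tt)
open import Function.Base using (_∘_; id; case_of_)
open import Function.Bundles using (Equivalence; Inverse)
open import Relation.Binary.Bundles using (Poset)
open import Relation.Binary.Construct.Closure.ReflexiveTransitive as Star
  using (Star; ε; _◅_; _◅◅_)
open import Relation.Binary.Lattice.Structures using (module IsLattice)
import Relation.Binary.Lattice.Properties.MeetSemilattice as MeetProperties
open import Relation.Binary.PropositionalEquality
  using (_≡_; refl; sym; trans; subst)
open import Relation.Nullary.Decidable
  using (Dec; yes; no; isYes; toWitness; fromWitness; decidable-stable)
open import Relation.Nullary.Negation using (¬_; contradiction)
open import Relation.Unary using (Pred; _∈_; _∉_; _⊆_; _≐_; Satisfiable)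
open import Relation.Unary.Properties using (≐-refl; ≐-sym; ≐-trans)

module _ (em : ∀ {a} → ExcludedMiddle a) where

  -- Primality of ultrafilters in a Boolean algebra.

  module _ {c ℓ} (𝔹 : BooleanAlgebra c ℓ) where
    private module 𝔹 = BooleanAlgebra 𝔹
    open BooleanAlgebra 𝔹 using (_∧_; _∨_; ⊥; ⊤) renaming (¬_ to ∁)
    open BooleanAlgebraProperties 𝔹
      using ( poset; ∨-∧-isOrderTheoreticLattice; ∧-orderTheoreticMeetSemilattice
            ; ∧-identityʳ; ∨-identityˡ; ∧-zeroʳ)
    open Poset poset using (_≤_) renaming (refl to ≤-refl; trans to ≤-trans)
    open IsLattice ∨-∧-isOrderTheoreticLattice using (x∧y≤x; x∧y≤y; ∧-greatest)
    open MeetProperties ∧-orderTheoreticMeetSemilattice using (∧-monotonic)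

    disjoint⇒≤∁ : ∀ {x y} → x ∧ y ≤ ⊥ → x ≤ ∁ y
    disjoint⇒≤∁ {x} {y} xy≤⊥ = begin
      x                      ≈⟨ ∧-identityʳ x ⟨
      x ∧ ⊤                  ≈⟨ 𝔹.∧-congˡ (𝔹.∨-complementʳ y) ⟨
      x ∧ (y ∨ ∁ y)          ≈⟨ 𝔹.∧-distribˡ-∨ x y (∁ y) ⟩
      -- The order `x ≤ y` unfolds to `x ≈ x ∧ y`, so `xy≤⊥` needs `∧-zeroʳ` to become `x ∧ y ≈ ⊥`;
      -- the whole chain is itself the inequality sought.
      (x ∧ y) ∨ (x ∧ ∁ y)    ≈⟨ 𝔹.∨-congʳ (𝔹.trans xy≤⊥ (∧-zeroʳ (x ∧ y))) ⟩
      ⊥ ∨ (x ∧ ∁ y)          ≈⟨ ∨-identityˡ (x ∧ ∁ y) ⟩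
      x ∧ ∁ y                ∎
      where open import Relation.Binary.Reasoning.Setoid 𝔹.setoid

    -- A member of the ultrafilter disjoint from `x` lies below `∁ x`. If there is none, the
    -- ultrafilter and `x` generate a proper filter, which maximality puts inside the ultrafilter.
    ultrafilter-prime : ∀ (u : Ultrafilter 𝔹) x → x ∈ proj₁ u ⊎ ∁ x ∈ proj₁ u
    ultrafilter-prime (𝓤 , isU) x with em {P = ∃ λ y → y ∈ 𝓤 × y ∧ x ≤ ⊥}
    ... | yes (y , y∈𝓤 , yx≤⊥) = inj₂ (upward-closed (disjoint⇒≤∁ yx≤⊥) y∈𝓤)
      where open IsUltrafilter isU
    ... | no meets =
      inj₁ (maximal generated (λ {y} y∈𝓤 → y , y∈𝓤 , x∧y≤x y x) x∈generated)
      where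
      open IsUltrafilter isU
      x∈generated : ∃ λ y → y ∈ 𝓤 × y ∧ x ≤ x
      x∈generated = let y , y∈𝓤 = nonempty in y , y∈𝓤 , x∧y≤y y x

      generated : IsFilter 𝔹 (λ z → ∃ λ y → y ∈ 𝓤 × y ∧ x ≤ z)
      generated = record
        { nonempty      = x , x∈generated
        ; upward-closed = λ z≤w (y , y∈𝓤 , yx≤z) → y , y∈𝓤 , ≤-trans yx≤z z≤w
        ; ∧-closed      = λ (y , y∈𝓤 , yx≤z) (y′ , y′∈𝓤 , y′x≤z′) →
            y ∧ y′ , ∧-closed y∈𝓤 y′∈𝓤 ,
            ∧-greatest (≤-trans (∧-monotonic (x∧y≤x y y′) ≤-refl) yx≤z)
                       (≤-trans (∧-monotonic (x∧y≤y y y′) ≤-refl) y′x≤z′)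
        ; proper        = meets
        }

  -- Classical tools for predicates.

  χ : ∀ {a p} {A : Set a} → Pred A p → A → Bool
  χ P x = isYes (em {P = P x})

  infinite∖finite : ∀ {a p q} {A : Set a} {P : Pred A p} {Q : Pred A q} →
                    Infinite P → Finite Q → ∃ λ x → x ∈ P × x ∉ Q
  infinite∖finite {P = P} {Q} infP finQ with em {P = ∃ λ x → x ∈ P × x ∉ Q}
  ... | yes found = found
  ... | no none   =
    contradiction (finite-⊆ P⊆Q finQ) infP
    where
    P⊆Q : P ⊆ Q
    P⊆Q x∈P = decidable-stable em λ x∉Q → none (_ , x∈P , x∉Q)

  -- Cuts, and components after deleting finitely many edges.

  module _ {ℓ} (G : Graph ℓ) where
    open Graph G
    open EdgeSet
    open EdgeDirection

    private
      𝔹 = cutAlgebra G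

      infix 4 _≤ᶜ_
      _≤ᶜ_ : Cut G → Cut G → Set ℓ
      _≤ᶜ_ = Poset._≤_ (BooleanAlgebraProperties.poset 𝔹)

    boundary : Cut G → FiniteEdgeSet G
    boundary (A , finA) = ∂ G A , finA

    ⊆⇒≤ᶜ : ∀ A B → (∀ x → T (proj₁ A x) → T (proj₁ B x)) → A ≤ᶜ B
    ⊆⇒≤ᶜ A B A⊆B = ≗⇒≈ G A (_∩ᶜ_ G A B) λ x → absorb (proj₁ A x) (proj₁ B x) (A⊆B x)
      where
      absorb : ∀ a b → (T a → T b) → a ≡ a Bool.∧ b
      absorb true  true  _   = refl
      absorb true  false a⇒b = contradiction (a⇒b tt) id
      absorb false _     _   = refl

    negligible⇒≤∅ : ∀ A → Negligible G (proj₁ A) → A ≤ᶜ ∅-cut G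
    negligible⇒≤∅ (A , _) = negl-⊆ G λ x → drop (A x)
      where
      drop : ∀ a → T (a xor (a Bool.∧ false)) → T a
      drop true  _ = tt
      drop false ()

    -- No edge outside `F` crosses `A`, so membership in `A` is preserved along every path avoiding
    -- `F`.
    constant-on-component : ∀ A F {C x y} → _⊆ᴱ_ G (∂ G A) F → IsComponent G F C →
                            x ∈ C → y ∈ C → A x ≡ A y
    constant-on-component A F ∂A⊆F (_ , C⊆ , _) x∈C y∈C =
      trans (sym (along (C⊆ x∈C))) (along (C⊆ y∈C))
      where
      along : ∀ {x y} → Star (AdjWithout G F) x y → A x ≡ A y
      along ε = refl
      along ((e , e∉F) ◅ p) =
        trans (decidable-stable em λ A≢ → e∉F (∂A⊆F (e , A≢))) (along p)

    component : FiniteEdgeSet G → V → Pred V ℓ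
    component (F , _) = Star (AdjWithout G F)

    -- Edge sets contain both orientations of each edge, so second coordinates alone cover all ends.
    ends : FiniteEdgeSet G → List V
    ends (_ , es , _) = map proj₂ es

    component-sym : ∀ F {x y} → component F x y → component F y x
    component-sym (F , _) = Star.reverse λ (e , e∉F) → symm e , e∉F ∘ edge-symm F

    ∂-component⊆ : ∀ F x → _⊆ᴱ_ G (∂ G (χ (component F x))) (proj₁ F)
    ∂-component⊆ F x {y} {z} (e , χ≢) with em {P = component F x y} | em {P = component F x z}
    ... | yes p | yes q = contradiction refl χ≢
    ... | no ¬p | no ¬q = contradiction refl χ≢
    ... | yes p | no ¬q = decidable-stable em λ e∉F → ¬q (p ◅◅ (e , e∉F) ◅ ε)
    ... | no ¬p | yes q =
      decidable-stable em λ e∉F → ¬p (q ◅◅ component-sym F ((e , e∉F) ◅ ε))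

    componentCut : FiniteEdgeSet G → V → Cut G
    componentCut F x = χ (component F x) , finite-⊆ (∂-component⊆ F x) (proj₂ F)

    -- A neighbour of a vertex of the component is either joined to it by an edge of `F`, hence in
    -- `ends F`, or lies in the component.
    finite-component-negligible : ∀ F x → Finite (component F x) →
                                  Negligible G (proj₁ (componentCut F x))
    finite-component-negligible F x (ys , C⊆ys) =
      (ys , C⊆ys ∘ toWitness) ,
      λ y y∈C → ends F ++ ys , neighbour (toWitness y∈C)
      where
      neighbour : ∀ {y z} → component F x y → Adj y z → z ∈ₗ ends F ++ ys
      neighbour {y} {z} p e with em {P = Edge (proj₁ F) y z}
      ... | yes e∈F = ∈-++⁺ˡ (∈-map⁺ proj₂ (proj₂ (proj₂ F) e∈F))
      ... | no e∉F  = ∈-++⁺ʳ (ends F) (C⊆ys (p ◅◅ (e , e∉F) ◅ ε))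

    -- Cutting a path after its last edge in `F` leaves a final segment avoiding `F`. Hence in a
    -- connected graph every component after deleting `F` contains `x` or a vertex of `ends F`.
    last-deleted-edge : ∀ (F : FiniteEdgeSet G) {x y} → Star Adj x y →
      component F x y ⊎ ∃ λ z → z ∈ₗ ends F × component F z y
    last-deleted-edge F ε = inj₁ ε
    last-deleted-edge F@(E , es , E⊆es) {x} (_◅_ {j = z} e p) with last-deleted-edge F p
    ... | inj₂ found = inj₂ found
    ... | inj₁ q with em {P = Edge E x z}
    ...   | yes f  = inj₂ (z , ∈-map⁺ proj₂ (E⊆es f) , q)
    ...   | no e∉E = inj₁ ((e , e∉E) ◅ q)

    -- From ultrafilters to directions.

    module _ (u : Ultrafilter 𝔹) where
      private 𝓤 = proj₁ u
      open IsUltrafilter (proj₂ u)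

      ultrafilter-⊆ : ∀ A B → (∀ x → T (proj₁ A x) → T (proj₁ B x)) → A ∈ 𝓤 → B ∈ 𝓤
      ultrafilter-⊆ A B A⊆B = upward-closed {A} {B} (⊆⇒≤ᶜ A B A⊆B)

      ultrafilter-¬negligible : ∀ A → A ∈ 𝓤 → ¬ Negligible G (proj₁ A)
      ultrafilter-¬negligible A A∈𝓤 negl =
        proper (upward-closed {A} {∅-cut G} (negligible⇒≤∅ A negl) A∈𝓤)

      ultrafilter-inhabited : ∀ A → A ∈ 𝓤 → Satisfiable (T ∘ proj₁ A)
      ultrafilter-inhabited A A∈𝓤 with em {P = Satisfiable (T ∘ proj₁ A)}
      ... | yes inhabited = inhabited
      ... | no empty      = contradiction
        (([] , λ {x} t → contradiction (x , t) empty) , λ x t → contradiction (x , t) empty)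
        (ultrafilter-¬negligible A A∈𝓤)

      -- Primality removes one component at a time from the cut A ∈ u until a
      -- component lies in u; this must happen as the empty cut is not in u.

      component∈ultrafilter : ∀ F xs A → A ∈ 𝓤 →
        (∀ x → T (proj₁ A x) → ∃ λ y → y ∈ₗ xs × component F y x) →
        ∃ λ y → componentCut F y ∈ 𝓤
      component∈ultrafilter F [] A A∈𝓤 cover
        with x , x∈A ← ultrafilter-inhabited A A∈𝓤
        with () ← proj₁ (proj₂ (cover x x∈A))
      component∈ultrafilter F (y ∷ xs) A A∈𝓤 cover
        with ultrafilter-prime 𝔹 u (componentCut F y)
      ... | inj₁ C∈𝓤  = y , C∈𝓤
      ... | inj₂ ∁C∈𝓤 =
        component∈ultrafilter F xs (_∩ᶜ_ G A (∁ᶜ G (componentCut F y)))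
          (∧-closed A∈𝓤 ∁C∈𝓤) cover′
        where
        not-witness : ∀ {p} {P : Set p} (P? : Dec P) → T (Bool.not (isYes P?)) → ¬ P
        not-witness (no ¬p) _ = ¬p
        cover′ : ∀ x → T (proj₁ A x Bool.∧ Bool.not (χ (component F y) x)) →
                 ∃ λ z → z ∈ₗ xs × component F z x
        cover′ x t with x∈A , x∉C ← Equivalence.to T-∧ t with cover x x∈A
        ... | _ , here refl , p = contradiction p (not-witness em x∉C)
        ... | z , there z∈ , p  = z , z∈ , p

      -- The intersection of two members is a member, hence nonempty. For `F = F′` this makes the
      -- component in `u` unique; for `F` inside `F′` it yields monotonicity.
      components-meet : ∀ F x F′ x′ → componentCut F x ∈ 𝓤 → componentCut F′ x′ ∈ 𝓤 →
                        ∃ λ y → component F x y × component F′ x′ y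
      components-meet F x F′ x′ C∈𝓤 C′∈𝓤 =
        let C   = componentCut F x
            C′  = componentCut F′ x′
            y , t = ultrafilter-inhabited (_∩ᶜ_ G C C′) (∧-closed {C} {C′} C∈𝓤 C′∈𝓤)
            y∈C , y∈C′ = Equivalence.to (T-∧ {proj₁ C y} {proj₁ C′ y}) t
        in y , toWitness y∈C , toWitness y∈C′

      module _ (connected : Connected G) where

        abstract
          root-with-component : ∀ F → ∃ λ y → componentCut F y ∈ 𝓤
          root-with-component F
            -- A base vertex comes from a member of `u`, since `G` may have no vertices.
            with A , A∈𝓤 ← nonempty
            with x₀ , _ ← ultrafilter-inhabited A A∈𝓤
            = component∈ultrafilter F (x₀ ∷ ends F) A A∈𝓤 λ x _ →
                case last-deleted-edge F (connected x₀ x) of λ where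
                  (inj₁ p)            → x₀ , here refl , p
                  (inj₂ (z , z∈ , p)) → z , there z∈ , p

        root : FiniteEdgeSet G → V
        root = proj₁ ∘ root-with-component

        root∈𝓤 : ∀ F → componentCut F (root F) ∈ 𝓤
        root∈𝓤 = proj₂ ∘ root-with-component

        ultrafilter⇒direction : EdgeDirection G
        ultrafilter⇒direction = record
          { direction = λ F →
              component F (root F) , (root F , ≐-refl) ,
              λ fin → ultrafilter-¬negligible (componentCut F (root F)) (root∈𝓤 F)
                        (finite-component-negligible F (root F) fin)
          ; monotone  = mono
          }
          where
          mono : ∀ F F′ → _⊆ᴱ_ G (proj₁ F) (proj₁ F′) →
                 component F′ (root F′) ⊆ component F (root F)
          mono F F′ F⊆F′ r′→y =
            let x , r→x , r′→x =
                  components-meet F (root F) F′ (root F′) (root∈𝓤 F) (root∈𝓤 F′)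
            in
            -- A path avoiding `F′` avoids the smaller set `F`, so both components can be joined
            -- through `x`.
            r→x ◅◅ Star.map (map₂ (_∘ F⊆F′)) (component-sym F′ r′→x ◅◅ r′→y)

        direction⊆⇒∈ultrafilter : ∀ F A → (ultrafilter⇒direction ⟨ F ⟩) ⊆ T ∘ proj₁ A → A ∈ 𝓤
        direction⊆⇒∈ultrafilter F A C⊆A =
          ultrafilter-⊆ (componentCut F (root F)) A (λ x → C⊆A ∘ toWitness) (root∈𝓤 F)

        ∈ultrafilter⇒direction : ∀ F x → componentCut F x ∈ 𝓤 → x ∈ (ultrafilter⇒direction ⟨ F ⟩)
        ∈ultrafilter⇒direction F x C∈𝓤 =
          let y , r→y , x→y = components-meet F (root F) F x (root∈𝓤 F) C∈𝓤 in
          r→y ◅◅ component-sym F x→y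

    -- From directions to ultrafilters.

    module _ (ρ : EdgeDirection G) where

      direction-component : ∀ F → IsComponent G (proj₁ F) (ρ ⟨ F ⟩)
      direction-component F = proj₁ (proj₂ (direction ρ F))

      direction-infinite : ∀ F → Infinite (ρ ⟨ F ⟩)
      direction-infinite F = proj₂ (proj₂ (direction ρ F))

      direction-inhabited : ∀ F → Satisfiable (ρ ⟨ F ⟩)
      direction-inhabited F = component-satisfiable G {proj₁ F} (direction-component F)

      -- Testing only at `boundary A` avoids quantifying over edge sets, which keeps the predicate
      -- at the level `ℓ` that ultrafilters require.
      PointsInto : Cut G → Set ℓ
      PointsInto A = (ρ ⟨ boundary A ⟩) ⊆ T ∘ proj₁ A

      -- Monotonicity moves the single vertex `x` into the component at `boundary A`, on which `A`
      -- is constant. Several cuts can thus be compared at one common `F`.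
      meets⇒pointsInto : ∀ A F {x} → _⊆ᴱ_ G (∂ G (proj₁ A)) (proj₁ F) →
                         x ∈ (ρ ⟨ F ⟩) → T (proj₁ A x) → PointsInto A
      meets⇒pointsInto A F ∂A⊆F x∈ρ x∈A y∈ρ =
        subst T (constant-on-component (proj₁ A) (∂ G (proj₁ A)) id
                  (direction-component (boundary A))
                  (monotone ρ (boundary A) F ∂A⊆F x∈ρ) y∈ρ) x∈A

      private
        infixl 5 _⊔_
        _⊔_ : FiniteEdgeSet G → FiniteEdgeSet G → FiniteEdgeSet G
        _⊔_ = _∪ᴱ_ G

      pointsInto-upward : ∀ A B → A ≤ᶜ B → PointsInto A → PointsInto B
      pointsInto-upward A B (A≈A∩B , _) ρ⊆A =
        -- `A ≤ᶜ B` allows a finite exceptional set, which the infinite component at `F` cannot be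
        -- contained in.
        let x , x∈ρ , x∉ = infinite∖finite (direction-infinite F) A≈A∩B in
        meets⇒pointsInto B F inj₂ x∈ρ
          (both (proj₁ A x) (proj₁ B x) (ρ⊆A (monotone ρ (boundary A) F inj₁ x∈ρ)) x∉)
        where
        F = boundary A ⊔ boundary B
        both : ∀ a b → T a → ¬ T (a xor (a Bool.∧ b)) → T b
        both true true  _ _ = tt
        both true false _ n = n tt

      pointsInto-∩ : ∀ A B → PointsInto A → PointsInto B → PointsInto (_∩ᶜ_ G A B)
      pointsInto-∩ A B ρ⊆A ρ⊆B =
        let x , x∈ρ = direction-inhabited F in
        meets⇒pointsInto A∩B F inj₂ x∈ρ (Equivalence.from T-∧
          ( ρ⊆A (monotone ρ (boundary A) F (inj₁ ∘ inj₁) x∈ρ)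
          , ρ⊆B (monotone ρ (boundary B) F (inj₁ ∘ inj₂) x∈ρ)))
        where
        A∩B = _∩ᶜ_ G A B
        F = boundary A ⊔ boundary B ⊔ boundary A∩B

      pointsInto-∁ : ∀ A → ¬ PointsInto A → PointsInto (∁ᶜ G A)
      pointsInto-∁ A ρ⊈A =
        let x , x∈ρ = direction-inhabited F in
        meets⇒pointsInto (∁ᶜ G A) F inj₂ x∈ρ
          (∉⇒∈∁ (proj₁ A x) λ x∈A → ρ⊈A (meets⇒pointsInto A F inj₁ x∈ρ x∈A))
        where
        F = boundary A ⊔ boundary (∁ᶜ G A)
        ∉⇒∈∁ : ∀ a → ¬ T a → T (Bool.not a)
        ∉⇒∈∁ true  n = contradiction tt n
        ∉⇒∈∁ false _ = tt

      pointsInto-isFilter : IsFilter 𝔹 PointsInto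
      pointsInto-isFilter = record
        { nonempty      = V-cut G , λ _ → tt
        ; upward-closed = λ {A} {B} → pointsInto-upward A B
        ; ∧-closed      = λ {A} {B} → pointsInto-∩ A B
        ; proper        = λ into → into (proj₂ (direction-inhabited (boundary (∅-cut G))))
        }

      -- If `ρ` does not point into `A`, it points into the complement; a filter containing both
      -- would contain the empty cut.
      pointsInto-maximal : {𝓕 : Pred (Cut G) ℓ} →
                           IsFilter 𝔹 𝓕 → PointsInto ⊆ 𝓕 → 𝓕 ⊆ PointsInto
      pointsInto-maximal isF ⊆𝓕 {A} A∈𝓕 = decidable-stable em λ ρ⊈A →
        proper (upward-closed {_∩ᶜ_ G A (∁ᶜ G A)} {∅-cut G}
          (⊆⇒≤ᶜ (_∩ᶜ_ G A (∁ᶜ G A)) (∅-cut G) λ y → subst T (∧-inverseʳ (proj₁ A y)))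
          (∧-closed A∈𝓕 (⊆𝓕 {∁ᶜ G A} (pointsInto-∁ A ρ⊈A))))
        where open IsFilter isF

      direction⇒ultrafilter : Ultrafilter 𝔹
      direction⇒ultrafilter = PointsInto , record
        { isFilter = pointsInto-isFilter
        ; maximal  = λ {𝓕} → pointsInto-maximal {𝓕}
        }

    -- The two maps are mutually inverse.

    module _ (connected : Connected G) where

      toDirection : Ultrafilter 𝔹 → EdgeDirection G
      toDirection u = ultrafilter⇒direction u connected

      -- For a vertex `x` of the component of `ρ` at `F`, the component cut of `x` lies in the
      -- ultrafilter of `ρ`, so both components contain `x`.
      direction⇒ultrafilter⇒direction : ∀ ρ F →
        (toDirection (direction⇒ultrafilter ρ) ⟨ F ⟩) ≐ (ρ ⟨ F ⟩)
      direction⇒ultrafilter⇒direction ρ F with x , x∈ρ ← direction-inhabited ρ F =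
        component-≐ G {proj₁ F} {x = x}
          (direction-component (toDirection u) F) (direction-component ρ F)
          (∈ultrafilter⇒direction u connected F x
            (meets⇒pointsInto ρ (componentCut F x) F (∂-component⊆ F x) x∈ρ (fromWitness ε)))
          x∈ρ
        where
        u = direction⇒ultrafilter ρ

      ultrafilter⇒direction⇒ultrafilter : ∀ u →
        proj₁ (direction⇒ultrafilter (toDirection u)) ≐ proj₁ u
      ultrafilter⇒direction⇒ultrafilter u =
        -- One inclusion suffices, as the left side is already maximal among filters.
        ⊆u , pointsInto-maximal (toDirection u) (IsUltrafilter.isFilter (proj₂ u)) ⊆u
        where
        ⊆u : PointsInto (toDirection u) ⊆ proj₁ u
        ⊆u {A} = direction⊆⇒∈ultrafilter u connected (boundary A) A

      -- Serves both well-definedness and continuity of `toDirection`: one cut in `v` fixes its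
      -- value at `F`.
      toDirection-component : ∀ u v F → componentCut F (root u connected F) ∈ proj₁ v →
                              (toDirection v ⟨ F ⟩) ≐ (toDirection u ⟨ F ⟩)
      toDirection-component u v F C∈v =
        component-≐ G {proj₁ F} {x = root u connected F}
          (direction-component (toDirection v) F) (direction-component (toDirection u) F)
          (∈ultrafilter⇒direction v connected F (root u connected F) C∈v) ε

      ultrafilter↔direction :
        Inverse (Space.points (Ult 𝔹)) (Space.points (edgeDirectionSpace G))
      ultrafilter↔direction = record
        { to        = toDirection
        ; from      = direction⇒ultrafilter
        ; to-cong   = λ {u} {v} → to-cong {u} {v}
        ; from-cong = λ {ρ} {σ} → from-cong {ρ} {σ}
        ; inverse   =
            (λ {ρ} {u} u≐ F → ≐-trans (to-cong {u} {direction⇒ultrafilter ρ} u≐ F)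
                                (direction⇒ultrafilter⇒direction ρ F)) ,
            (λ {u} {ρ} ρ≐ → ≐-trans (from-cong {ρ} {toDirection u} ρ≐)
                              (ultrafilter⇒direction⇒ultrafilter u))
        }
        where
        to-cong : ∀ {u v} → proj₁ u ≐ proj₁ v →
                  ∀ F → (toDirection u ⟨ F ⟩) ≐ (toDirection v ⟨ F ⟩)
        to-cong {u} {v} (_ , v⊆u) F = toDirection-component v u F (v⊆u (root∈𝓤 v connected F))

        from-cong : ∀ {ρ σ} → (∀ F → (ρ ⟨ F ⟩) ≐ (σ ⟨ F ⟩)) → PointsInto ρ ≐ PointsInto σ
        from-cong ρ≐σ =
          (λ {A} ρ⊆A → ρ⊆A ∘ proj₂ (ρ≐σ (boundary A))) ,
          (λ {A} σ⊆A → σ⊆A ∘ proj₁ (ρ≐σ (boundary A)))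

theorem13 : (∀ {a} → ExcludedMiddle a) →
    ∀ {ℓ} (G : Graph ℓ) → Connected G →
    Homeomorphism (Ult (cutAlgebra G)) (edgeDirectionSpace G)
theorem13 em G connected = record
  { bijection       = ultrafilter↔direction em G connected
  ; to-continuous   = λ U U-open {u} ρ∈U →
      let (σ , F) , ρ≐σ , σ-basic⊆U = U-open ρ∈U in
      componentCut em G F (root em G u connected F) , root∈𝓤 em G u connected F ,
      λ {v} C∈v → σ-basic⊆U (≐-trans (toDirection-component em G connected u v F C∈v) ρ≐σ)
  ; from-continuous = λ U U-open {ρ} u∈U →
      let A , ρ⊆A , A-basic⊆U = U-open u∈U in
      (ρ , boundary em G A) , ≐-refl ,
      λ {σ} σ≐ρ → A-basic⊆U {direction⇒ultrafilter em G σ} (ρ⊆A ∘ proj₁ σ≐ρ)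
  }
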